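{- There are no trinomials $x^5+Ax^2+B$ with $A,B\in\mathbb{Q}$, $AB\neq0$, having reducibility type $(1,2,2)$ or $(1,1,1,2)$.
   Context: A monic polynomial in $\mathbb{Q}[x]$ has reducibility type $(n_1,\dots,n_k)$, $n_1\le\dots\le n_k$, if it factors as a product of $k$ irreducible polynomials in $\mathbb{Q}[x]$ (not necessarily distinct) of degrees $n_1,\dots,n_k$. -}

module Defs where

open import Algebra.Bundles using (RawSemiring)
import Algebra.Definitions.RawSemiring as RawSemiringDefinitions
open import Data.List.Base using (List; []; _∷_; map; foldr)
open import Data.List.Relation.Binary.Pointwise using (Pointwise)
open import Data.List.Relation.Unary.Sorted.TotalOrder using (Sorted)
open import Data.Nat.Base as ℕ using (ℕ; zero; suc)
open import Data.Nat.Properties using (≤-totalOrder)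
open import Data.Product.Base using (_×_; ∃-syntax)
open import Data.Rational.Base as ℚ using (ℚ; 0ℚ; 1ℚ)
open import Level using (0ℓ)
open import Relation.Binary.PropositionalEquality.Core using (_≡_; _≢_)

-- Coefficient lists, constant term first.  Trailing zeros are allowed, so
-- equality of polynomials is _≈_ below, not _≡_.
ℚ[x] : Set
ℚ[x] = List ℚ

coeff : ℚ[x] → ℕ → ℚ
coeff []      n       = 0ℚ
coeff (a ∷ p) zero    = a
coeff (a ∷ p) (suc n) = coeff p n

infix  4 _≈_
infixl 6 _+_
infixl 7 _*_

_≈_ : ℚ[x] → ℚ[x] → Set
p ≈ q = ∀ n → coeff p n ≡ coeff q n

_+_ : ℚ[x] → ℚ[x] → ℚ[x]
[]      + q       = q
(a ∷ p) + []      = a ∷ p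
(a ∷ p) + (b ∷ q) = (a ℚ.+ b) ∷ (p + q)

-- (a + x p) q = a q + x (p q)
_*_ : ℚ[x] → ℚ[x] → ℚ[x]
[]      * q = []
(a ∷ p) * q = map (a ℚ.*_) q + (0ℚ ∷ p * q)

ℚ[x]-rawSemiring : RawSemiring 0ℓ 0ℓ
ℚ[x]-rawSemiring = record
  { Carrier = ℚ[x]
  ; _≈_     = _≈_
  ; _+_     = _+_
  ; _*_     = _*_
  ; 0#      = []
  ; 1#      = 1ℚ ∷ []
  }

-- Irreducible p: p is not a unit (does not divide 1), and in every
-- factorisation of p into two factors one of them is a unit.  The zero
-- polynomial is excluded by 0 ≈ 0 * 0.
open RawSemiringDefinitions ℚ[x]-rawSemiring public using (Irreducible)

product : List ℚ[x] → ℚ[x]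
product = foldr _*_ (1ℚ ∷ [])

HasDegree : ℚ[x] → ℕ → Set
HasDegree p n = coeff p n ≢ 0ℚ × (∀ m → n ℕ.< m → coeff p m ≡ 0ℚ)

Monic : ℚ[x] → Set
Monic p = ∃[ n ] (HasDegree p n × coeff p n ≡ 1ℚ)

record HasReducibilityType (p : ℚ[x]) (ns : List ℕ) : Set where
  field
    monic               : Monic p
    sorted              : Sorted ≤-totalOrder ns
    factors             : List ℚ[x]
    factors-irreducible : Pointwise (λ f n → Irreducible f × HasDegree f n) factors ns
    factorisation       : p ≈ product factors

-- x⁵ + A x² + B
trinomial : ℚ → ℚ → ℚ[x]
trinomial A B = B ∷ 0ℚ ∷ A ∷ 0ℚ ∷ 0ℚ ∷ 1ℚ ∷ []

{-# OPTIONS --safe #-}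
module Submission where

open import Data.Empty using (⊥; ⊥-elim)
open import Data.Integer.Base as ℤ using ()
import Data.Integer.Properties as ℤ
open import Data.List.Base using ([]; _∷_; map; drop)
open import Data.Maybe.Base using (just; nothing)
open import Data.Nat.Base as ℕ using (ℕ; zero; suc; z≤n; s≤s)
open import Data.Nat.Coprimality as Coprime using (Coprime)
import Data.Nat.Properties as ℕ
import Data.Nat.Tactic.RingSolver as ℕ-Solver
open import Data.Product.Base using (_×_; _,_; ∃-syntax)
open import Data.Rational.Base as ℚ using (ℚ; mkℚ; 0ℚ; 1ℚ; toℚᵘ)
import Data.Rational.Properties as ℚ
open import Data.Rational.Unnormalised.Base as ℚᵘ using (*≡*; _≃_)
import Data.Rational.Unnormalised.Properties as ℚᵘ
open import Data.Sum.Base using (_⊎_; inj₁; inj₂; reduce)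
open import Function.Base using (case_of_; it)
open import Level using (0ℓ)
open import Relation.Binary.PropositionalEquality
open import Relation.Nullary using (¬_; contradiction; yes; no)
open import Relation.Nullary.Decidable using (from-yes; _→-dec_; _⊎-dec_)
import Tactic.RingSolver as RingSolver
open import Tactic.RingSolver.Core.AlmostCommutativeRing using (AlmostCommutativeRing; fromCommutativeRing)

-- Let (x + R)(x² + A x + b)(x² + C x + d) have no terms in x⁴, x³ and x.  Then
-- R = -(A + C), d = A² + A C + C² - b, and what remains is a quadratic equation
-- for b.  With p = A - C and q = A + C, its discriminant yields a rational y with
-- y² = (p² - q²)(p² + 15 q²).  If q ≠ 0, take p / q in lowest terms: up to a
-- common factor dividing 16, which congruences force to be a square, p² - q² = u²
-- and p² + 15 q² = v².  So u² + q² and u² + 16 q² are both squares.  Comparing the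
-- parametrisations of these two Pythagorean triples gives a smaller such pair
-- (u , q), and infinite descent forces p² = q², that is A C = 0, and then b d = 0.

-- Eliminating R and d leaves b² - (2 A² + A C) b + A (A + C)(A² + A C + C²) = 0, with discriminant
-- -A C (4 A² + 7 A C + 4 C²). Since p² - q² = -4 A C and p² + 15 q² = 4 (4 A² + 7 A C + 4 C²), the
-- quartic is 16 times this discriminant. The two factors differ by 16 q², whence the 16 that bounds
-- their common factor. The case q = 0 is harmless: it means R = 0.
--
-- The descent closes because the two triples share the odd leg u: u = y² - x² = w² - z², with q = 2
-- x y and z w = 4 x y. Splitting off a gcd turns these equations into β² (α² + δ²) = γ² (α² + 16
-- δ²), where the two original forms reappear, now with δ dividing q / 2.

module QuarticDescent where
  open import Data.Nat.Base
  open import Data.Nat.Properties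
  open import Data.Nat.Coprimality using (coprime-/gcd; coprime-divisor; coprime-factors)
  open import Data.Nat.Divisibility
  open import Data.Nat.DivMod using (_/_; _%_; [m+kn]%n≡m%n; m/n*n≡m)
  open import Data.Nat.GCD using (gcd; gcd[m,n]∣m; gcd[m,n]∣n; gcd[m,n]≡0⇒m≡0)
  open import Data.Nat.Induction using (<-rec)
  open import Data.Nat.Tactic.RingSolver using (solve; solve-∀)
  open ≡-Reasoning

  -- Parity and residues of squares

  Even Odd : ℕ → Set
  Even n = ∃[ k ] n ≡ 2 * k
  Odd  n = ∃[ k ] n ≡ 1 + 2 * k

  even-or-odd : ∀ n → Even n ⊎ Odd n
  even-or-odd zero = inj₁ (0 , refl)
  even-or-odd (suc n) with even-or-odd n
  ... | inj₁ (k , refl) = inj₂ (k , refl)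
  ... | inj₂ (k , refl) = inj₁ (suc k , cong suc (sym (+-suc k (k + 0))))

  even-odd-⊥ : ∀ {n} → Even n → Odd n → ⊥
  even-odd-⊥ (k , eq) (l , eq′) = even≢odd k l (trans (sym eq) eq′)

  odd-factorˡ : ∀ {m n} → Odd (m * n) → Odd m
  odd-factorˡ {m} {n} o with even-or-odd m
  ... | inj₂ om = om
  ... | inj₁ (k , refl) = ⊥-elim (even-odd-⊥ (k * n , *-assoc 2 k n) o)

  odd-factorʳ : ∀ {m n} → Odd (m * n) → Odd n
  odd-factorʳ {m} {n} (k , eq) = odd-factorˡ (k , trans (*-comm n m) eq)

  odd⇒nonZero : ∀ {n} → Odd n → NonZero n
  odd⇒nonZero (k , refl) = _

  even-square : ∀ {n} → Even n → ∃[ t ] n * n ≡ 4 * t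
  even-square (k , refl) = k * k , solve (k ∷ [])

  -- (1 + 2 k)² = 1 + 4 k (k + 1), and one of k and k + 1 is even.
  odd-square : ∀ {n} → Odd n → ∃[ t ] n * n ≡ 1 + 8 * t
  odd-square (k , refl) with even-or-odd k
  ... | inj₁ (j , refl) = j * (1 + 2 * j) , solve (j ∷ [])
  ... | inj₂ (j , refl) = (1 + 2 * j) * (1 + j) , solve (j ∷ [])

  -- The form in which all congruence arguments run: once both sides of an equation are a numeral
  -- plus a multiple of `d`, the numerals are compared by evaluation.
  residues : ∀ d .{{_ : NonZero d}} a b x y → a + x * d ≡ b + y * d → a % d ≡ b % d
  residues d a b x y eq = begin
    a % d           ≡⟨ [m+kn]%n≡m%n a x d ⟨
    (a + x * d) % d ≡⟨ cong (_% d) eq ⟩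
    (b + y * d) % d ≡⟨ [m+kn]%n≡m%n b y d ⟩
    b % d           ∎

  -- Coprimality, gcds and perfect squares

  coprime-*ʳ : ∀ {a b c} → Coprime a b → Coprime a c → Coprime a (b * c)
  coprime-*ʳ {a} {b} a⊥b a⊥c {d} (d∣a , d∣bc) = a⊥c (d∣a , coprime-divisor d⊥b d∣bc)
    where
    d⊥b : Coprime d b
    d⊥b (e∣d , e∣b) = a⊥b (∣-trans e∣d d∣a , e∣b)

  coprime-*ˡ : ∀ {a b c} → Coprime a c → Coprime b c → Coprime (a * b) c
  coprime-*ˡ a⊥c b⊥c = Coprime.sym (coprime-*ʳ (Coprime.sym a⊥c) (Coprime.sym b⊥c))

  coprime-squares : ∀ {a b} → Coprime a b → Coprime (a * a) (b * b)
  coprime-squares a⊥b = coprime-*ˡ (coprime-*ʳ a⊥b a⊥b) (coprime-*ʳ a⊥b a⊥b)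

  coprime-∣ : ∀ {a b c d} → c ∣ a → d ∣ b → Coprime a b → Coprime c d
  coprime-∣ c∣a d∣b a⊥b (e∣c , e∣d) = a⊥b (∣-trans e∣c c∣a , ∣-trans e∣d d∣b)

  odd-coprime-2 : ∀ {n} → Odd n → Coprime n 2
  odd-coprime-2 {n} (k , refl) {d} (d∣n , d∣2) =
    ∣1⇒≡1 (∣m+n∣m⇒∣n (subst (d ∣_) (+-comm 1 (2 * k)) d∣n) (∣m⇒∣m*n k d∣2))

  odd-coprime-4 : ∀ {n} → Odd n → Coprime n 4
  odd-coprime-4 o = coprime-*ʳ {b = 2} (odd-coprime-2 o) (odd-coprime-2 o)

  evens-not-coprime : ∀ {m n} → Even m → Even n → ¬ Coprime m n
  evens-not-coprime (k , refl) (l , refl) m⊥n = contradiction (m⊥n (m∣m*n {2} k , m∣m*n {2} l)) λ ()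

  gcd-split : ∀ m n .{{_ : NonZero m}} →
    ∃[ g ] ∃[ m′ ] ∃[ n′ ] NonZero g × m ≡ m′ * g × n ≡ n′ * g × Coprime m′ n′
  gcd-split m n =
    gcd m n , m / gcd m n , n / gcd m n , gcd≢0 ,
    sym (m/n*n≡m (gcd[m,n]∣m m n)) , sym (m/n*n≡m (gcd[m,n]∣n m n)) , coprime-/gcd m n
    where instance
      gcd≢0 : NonZero (gcd m n)
      gcd≢0 = ≢-nonZero λ eq → ≢-nonZero⁻¹ m (gcd[m,n]≡0⇒m≡0 eq)

  -- Dividing out the gcd leaves m′² ∣ n′² with m′ and n′ coprime, which forces m′ = 1; prime
  -- factorisations are avoided.
  square-∣⇒∣ : ∀ m n → m * m ∣ n * n → m ∣ n
  square-∣⇒∣ zero n 0∣n² with m*n≡0⇒m≡0∨n≡0 n (0∣⇒≡0 0∣n²)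
  ... | inj₁ refl = ∣-refl
  ... | inj₂ refl = ∣-refl
  square-∣⇒∣ m@(suc _) n m²∣n² with gcd-split m n
  ... | g , m′ , n′ , g≢0 , m≡ , n≡ , m′⊥n′ =
    subst₂ _∣_ (sym (trans m≡ (cong (_* g) m′≡1))) (sym n≡) (*-monoˡ-∣ g (1∣ n′))
    where
    instance _ = g≢0
             _ = m*n≢0 g g
    m′²∣n′² : m′ * m′ ∣ n′ * n′
    m′²∣n′² = *-cancelʳ-∣ (g * g) (subst₂ _∣_ (regroup m m′ m≡) (regroup n n′ n≡) m²∣n²)
      where
      regroup : ∀ k k′ → k ≡ k′ * g → k * k ≡ k′ * k′ * (g * g)
      regroup k k′ eq = trans (cong₂ _*_ eq eq) (solve (k′ ∷ g ∷ []))
    m′≡1 : m′ ≡ 1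
    m′≡1 = m′⊥n′ (∣-refl , coprime-divisor m′⊥n′ (∣-trans (m∣m*n m′) m′²∣n′²))

  square-injective : ∀ m n → m * m ≡ n * n → m ≡ n
  square-injective m n eq =
    ∣-antisym (square-∣⇒∣ m n (∣-reflexive eq)) (square-∣⇒∣ n m (∣-reflexive (sym eq)))

  -- The root is g = gcd(a, c). With a = a′ g and c = c′ g, the equation becomes a′ b = c′² g. Then
  -- a′ ∣ g because a′ is coprime to c′, and g ∣ a′ because g, a divisor of a, is coprime to b.
  coprime-product-square : ∀ a b c → Coprime a b → a * b ≡ c * c → ∃[ m ] a ≡ m * m
  coprime-product-square zero b c _ _ = 0 , refl
  coprime-product-square a@(suc _) b c a⊥b ab≡c² with gcd-split a c
  ... | g , a′ , c′ , g≢0 , a≡ , c≡ , a′⊥c′ =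
    g , trans a≡ (cong (_* g) (∣-antisym a′∣g g∣a′))
    where
    instance _ = g≢0
    a′b≡c′²g : a′ * b ≡ c′ * (c′ * g)
    a′b≡c′²g = *-cancelʳ-≡ _ _ g (begin
      a′ * b * g          ≡⟨ solve (a′ ∷ b ∷ g ∷ []) ⟩
      a′ * g * b          ≡⟨ cong (_* b) a≡ ⟨
      a * b               ≡⟨ ab≡c² ⟩
      c * c               ≡⟨ cong₂ _*_ c≡ c≡ ⟩
      c′ * g * (c′ * g)   ≡⟨ solve (c′ ∷ g ∷ []) ⟩
      c′ * (c′ * g) * g   ∎)
    a′∣g : a′ ∣ g
    a′∣g = coprime-divisor a′⊥c′ (coprime-divisor a′⊥c′ (subst (a′ ∣_) a′b≡c′²g (m∣m*n b)))
    g∣a′ : g ∣ a′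
    g∣a′ = coprime-divisor (coprime-∣ (subst (g ∣_) (sym a≡) (n∣m*n a′)) ∣-refl a⊥b)
      (subst (g ∣_) (trans (sym a′b≡c′²g) (*-comm a′ b)) (∣n⇒∣m*n c′ (n∣m*n c′)))

  coprime-product-squares : ∀ a b c → Coprime a b → a * b ≡ c * c →
    ∃[ m ] ∃[ n ] a ≡ m * m × b ≡ n * n × c ≡ m * n
  coprime-product-squares a b c a⊥b ab≡c²
    with coprime-product-square a b c a⊥b ab≡c²
       | coprime-product-square b a c (Coprime.sym a⊥b) (trans (*-comm b a) ab≡c²)
  ... | m , refl | n , refl = m , n , refl , refl ,
    square-injective c (m * n) (trans (sym ab≡c²) (solve (m ∷ n ∷ [])))

  -- From two equations in four numbers back to the two forms

  divisor-of-15 : ∀ {g} → g < 16 → g ∣ 15 → g % 8 ≡ 1 → g ≡ 1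
  -- The divisors 1, 3, 5, 15 have the distinct residues 1, 3, 5, 7 modulo 8.
  divisor-of-15 = from-yes (allUpTo? (λ g → g ∣? 15 →-dec (g % 8 ≟ 1 →-dec g ≟ 1)) 16)

  -- g divides 15 α² and 15 δ², hence 15, and g ≡ 1 (mod 8) as α and β are odd.
  common-ratio≡1 : ∀ {α β δ} γ g → Odd α → Odd β → Coprime α δ →
    α * α + δ * δ ≡ g * (γ * γ) → α * α + 16 * (δ * δ) ≡ g * (β * β) → g ≡ 1
  common-ratio≡1 {α} {β} {δ} γ g odd-α odd-β α⊥δ first second =
    divisor-of-15 (s≤s (∣⇒≤ g∣15)) g∣15 g%8≡1
    where
    g∣first : g ∣ α * α + δ * δ
    g∣first = subst (g ∣_) (sym first) (m∣m*n _)
    g∣second : g ∣ α * α + 16 * (δ * δ)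
    g∣second = subst (g ∣_) (sym second) (m∣m*n _)
    g∣15α² : g ∣ α * α * 15
    g∣15α² = ∣m+n∣m⇒∣n (subst (g ∣_) (split (α * α) (δ * δ)) (∣n⇒∣m*n 16 g∣first)) g∣second
      where
      split : ∀ a d → 16 * (a + d) ≡ (a + 16 * d) + a * 15
      split = solve-∀
    g∣15δ² : g ∣ δ * δ * 15
    g∣15δ² = ∣m+n∣m⇒∣n (subst (g ∣_) (split (α * α) (δ * δ)) g∣second) g∣first
      where
      split : ∀ a d → a + 16 * d ≡ (a + d) + d * 15
      split = solve-∀
    g∣15 : g ∣ 15
    g∣15 = coprime-factors (coprime-squares α⊥δ) (g∣15α² , g∣15δ²)
    g%8≡1 : g % 8 ≡ 1
    g%8≡1 with odd-square odd-α | odd-square odd-β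
    ... | a , α²≡ | b , β²≡ = sym (residues 8 1 g (a + 2 * (δ * δ)) (b * g) (begin
      1 + (a + 2 * (δ * δ)) * 8     ≡⟨ left a (δ * δ) ⟩
      1 + 8 * a + 16 * (δ * δ)      ≡⟨ cong (_+ 16 * (δ * δ)) α²≡ ⟨
      α * α + 16 * (δ * δ)          ≡⟨ second ⟩
      g * (β * β)                   ≡⟨ cong (g *_) β²≡ ⟩
      g * (1 + 8 * b)               ≡⟨ right b g ⟩
      g + b * g * 8                 ∎))
      where
      left : ∀ a d → 1 + (a + 2 * d) * 8 ≡ 1 + 8 * a + 16 * d
      left = solve-∀
      right : ∀ b g → g * (1 + 8 * b) ≡ g + b * g * 8
      right = solve-∀

  -- γ² is coprime to β², so it divides α² + δ². The quotient g is then also the quotient of α² + 16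
  -- δ² by β², and `common-ratio≡1` removes it.
  proportional-forms : ∀ {α β γ δ} → Odd α → Odd β → Odd γ → Coprime α δ → Coprime β γ →
    β * β * (α * α + δ * δ) ≡ γ * γ * (α * α + 16 * (δ * δ)) →
    α * α + δ * δ ≡ γ * γ × α * α + 16 * (δ * δ) ≡ β * β
  proportional-forms {α} {β} {γ} {δ} odd-α odd-β odd-γ α⊥δ β⊥γ proportion
    with coprime-divisor (coprime-squares (Coprime.sym β⊥γ))
           (subst (γ * γ ∣_) (sym proportion) (m∣m*n _))
  ... | divides g first = collapse first , collapse second
    where
    instance
      γ≢0 : NonZero γ
      γ≢0 = odd⇒nonZero odd-γ
      γ²≢0 : NonZero (γ * γ)
      γ²≢0 = m*n≢0 γ γ
    second : α * α + 16 * (δ * δ) ≡ g * (β * β)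
    second = *-cancelˡ-≡ _ _ (γ * γ) (begin
      γ * γ * (α * α + 16 * (δ * δ))  ≡⟨ proportion ⟨
      β * β * (α * α + δ * δ)         ≡⟨ cong (β * β *_) first ⟩
      β * β * (g * (γ * γ))           ≡⟨ swap (β * β) g (γ * γ) ⟩
      γ * γ * (g * (β * β))           ∎)
      where
      swap : ∀ a b c → a * (b * c) ≡ c * (b * a)
      swap = solve-∀
    collapse : ∀ {x y} → x ≡ g * y → x ≡ y
    collapse {x} {y} eq = trans eq (trans
      (cong (_* y) (common-ratio≡1 γ g odd-α odd-β α⊥δ first second)) (*-identityˡ y))

  -- Cancelling α leaves β l = 4 γ n, where β is coprime to γ and, being odd, to 4.
  odd-cofactor-∣ : ∀ α {β γ l n} → Odd (β * α) → Coprime β γ →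
    β * α * l ≡ 4 * (γ * α * n) → β ∣ n
  odd-cofactor-∣ α {β} {γ} {l} {n} odd-βα β⊥γ eq =
    coprime-divisor (odd-coprime-4 (odd-factorˡ {β} odd-βα))
      (coprime-divisor β⊥γ (subst (β ∣_) βl≡γ4n (m∣m*n l)))
    where
    βl≡γ4n : β * l ≡ γ * (4 * n)
    βl≡γ4n = *-cancelˡ-≡ _ _ α {{odd⇒nonZero (odd-factorʳ {β} odd-βα)}} (begin
      α * (β * l)         ≡⟨ left α β l ⟩
      β * α * l           ≡⟨ eq ⟩
      4 * (γ * α * n)     ≡⟨ right α γ n ⟩
      α * (γ * (4 * n))   ∎)
      where
      left : ∀ α β l → α * (β * l) ≡ β * α * l
      left = solve-∀
      right : ∀ α γ n → 4 * (γ * α * n) ≡ α * (γ * (4 * n))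
      right = solve-∀

  -- With k = β α, m = γ α and n = δ β, the product equation gives l = 4 γ δ.
  four-number-descent : ∀ {m n k} l → Odd m → Odd k → Coprime m n →
    k * l ≡ 4 * (m * n) → k * k + n * n ≡ m * m + l * l →
    ∃[ α ] ∃[ δ ] ∃[ β ] ∃[ γ ] Odd α × Coprime α δ × δ ∣ n ×
      α * α + δ * δ ≡ γ * γ × α * α + 16 * (δ * δ) ≡ β * β
  four-number-descent {m} {n} {k} l odd-m odd-k m⊥n kl≡4mn k²+n²≡m²+l²
    with gcd-split k m {{odd⇒nonZero odd-k}}
  ... | α , β , γ , _ , refl , refl , β⊥γ
    with odd-cofactor-∣ α odd-k β⊥γ kl≡4mn
  ... | divides δ refl =
    α , δ , β , γ , odd-α , α⊥δ , m∣m*n β ,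
    proportional-forms odd-α odd-β (odd-factorˡ {γ} odd-m) α⊥δ β⊥γ proportion
    where
    odd-α : Odd α
    odd-α = odd-factorʳ {β} odd-k
    odd-β : Odd β
    odd-β = odd-factorˡ {β} odd-k
    α⊥δ : Coprime α δ
    α⊥δ = coprime-∣ (n∣m*n γ) (m∣m*n β) m⊥n
    instance
      β≢0 : NonZero β
      β≢0 = odd⇒nonZero odd-β
      βα≢0 : NonZero (β * α)
      βα≢0 = odd⇒nonZero odd-k
    l≡4γδ : l ≡ 4 * (γ * δ)
    l≡4γδ = *-cancelˡ-≡ _ _ (β * α) (begin
      β * α * l                   ≡⟨ kl≡4mn ⟩
      4 * (γ * α * (δ * β))       ≡⟨ regroup α β γ δ ⟩
      β * α * (4 * (γ * δ))       ∎)
      where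
      regroup : ∀ α β γ δ → 4 * (γ * α * (δ * β)) ≡ β * α * (4 * (γ * δ))
      regroup = solve-∀
    proportion : β * β * (α * α + δ * δ) ≡ γ * γ * (α * α + 16 * (δ * δ))
    proportion = begin
      β * β * (α * α + δ * δ)                         ≡⟨ left α β δ ⟩
      β * α * (β * α) + δ * β * (δ * β)               ≡⟨ k²+n²≡m²+l² ⟩
      γ * α * (γ * α) + l * l                         ≡⟨ cong (λ l → γ * α * (γ * α) + l * l) l≡4γδ ⟩
      γ * α * (γ * α) + 4 * (γ * δ) * (4 * (γ * δ))   ≡⟨ right α γ δ ⟩
      γ * γ * (α * α + 16 * (δ * δ))                  ∎
      where
      left : ∀ α β δ → β * β * (α * α + δ * δ) ≡ β * α * (β * α) + δ * β * (δ * β)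
      left = solve-∀
      right : ∀ α γ δ → γ * α * (γ * α) + 4 * (γ * δ) * (4 * (γ * δ)) ≡ γ * γ * (α * α + 16 * (δ * δ))
      right = solve-∀

  -- Concordant forms u² + q² and u² + 16 q²

  -- Modulo 4, p must be odd, so p - u is an even number 2 s; then p² - u² = 4 s (u + s).
  odd-square-difference : ∀ {u w} p → Odd u → u * u + 4 * w ≡ p * p →
    ∃[ s ] p ≡ u + 2 * s × s * (u + s) ≡ w
  odd-square-difference {u} {w} p odd-u eq with even-or-odd p
  ... | inj₁ even-p with odd-square odd-u | even-square even-p
  ...   | a , u²≡ | b , p²≡ = contradiction (residues 4 1 0 (2 * a + w) b (begin
    1 + (2 * a + w) * 4   ≡⟨ solve (a ∷ w ∷ []) ⟩
    1 + 8 * a + 4 * w     ≡⟨ cong (_+ 4 * w) u²≡ ⟨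
    u * u + 4 * w         ≡⟨ eq ⟩
    p * p                 ≡⟨ p²≡ ⟩
    4 * b                 ≡⟨ *-comm 4 b ⟩
    b * 4                 ∎)) λ ()
  odd-square-difference {u} {w} p odd-u eq | inj₂ odd-p with m≤n⇒∃[o]m+o≡n u≤p
    where
    u≤p : u ≤ p
    u≤p = ≮⇒≥ λ p<u → <⇒≱ (*-mono-< p<u p<u) (subst (u * u ≤_) eq (m≤m+n _ _))
  ... | d , refl with even-or-odd d
  odd-square-difference {u} {w} _ odd-u eq | inj₂ odd-p | _ , refl | inj₁ (s , refl) =
    s , refl , *-cancelˡ-≡ _ _ 4 (+-cancelˡ-≡ (u * u) _ _ (trans (square u s) (sym eq)))
    where
    square : ∀ u s → u * u + 4 * (s * (u + s)) ≡ (u + 2 * s) * (u + 2 * s)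
    square = solve-∀
  odd-square-difference _ (j , refl) eq | inj₂ odd-p | _ , refl | inj₂ (k , refl) =
    contradiction odd-p (even-odd-⊥ (1 + j + k , solve (j ∷ k ∷ [])))

  opposite-parity : ∀ {u} x y → Odd u → u + x * x ≡ y * y → (Even x × Odd y) ⊎ (Odd x × Even y)
  opposite-parity {u} x y (k , u≡) eq with even-or-odd x | even-or-odd y
  ... | inj₁ even-x | inj₂ odd-y = inj₁ (even-x , odd-y)
  ... | inj₂ odd-x | inj₁ even-y = inj₂ (odd-x , even-y)
  ... | inj₁ even-x | inj₁ even-y with even-square even-x | even-square even-y
  ...   | a , x²≡ | b , y²≡ = contradiction (residues 2 1 0 (k + 2 * a) (2 * b) (begin
    1 + (k + 2 * a) * 2   ≡⟨ solve (a ∷ k ∷ []) ⟩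
    1 + 2 * k + 4 * a     ≡⟨ cong₂ _+_ u≡ x²≡ ⟨
    u + x * x             ≡⟨ eq ⟩
    y * y                 ≡⟨ y²≡ ⟩
    4 * b                 ≡⟨ solve (b ∷ []) ⟩
    2 * b * 2             ∎)) λ ()
  opposite-parity {u} x y (k , u≡) eq | inj₂ odd-x | inj₂ odd-y with odd-square odd-x | odd-square odd-y
  ...   | a , x²≡ | b , y²≡ = contradiction (residues 2 0 1 (1 + k + 4 * a) (4 * b) (begin
    (1 + k + 4 * a) * 2        ≡⟨ solve (a ∷ k ∷ []) ⟩
    1 + 2 * k + (1 + 8 * a)    ≡⟨ cong₂ _+_ u≡ x²≡ ⟨
    u + x * x                  ≡⟨ eq ⟩
    y * y                      ≡⟨ y²≡ ⟩
    1 + 8 * b                  ≡⟨ solve (b ∷ []) ⟩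
    1 + 4 * b * 2              ∎)) λ ()

  even+even≢odd+odd : ∀ {a b c d} → Even a → Even b → Odd c → Odd d → a * a + b * b ≢ c * c + d * d
  even+even≢odd+odd {a} {b} {c} {d} even-a even-b odd-c odd-d eq
    with even-square even-a | even-square even-b | odd-square odd-c | odd-square odd-d
  ... | s , a²≡ | t , b²≡ | v , c²≡ | w , d²≡ = contradiction (residues 4 0 2 (s + t) (2 * v + 2 * w) (begin
    (s + t) * 4                   ≡⟨ solve (s ∷ t ∷ []) ⟩
    4 * s + 4 * t                 ≡⟨ cong₂ _+_ a²≡ b²≡ ⟨
    a * a + b * b                 ≡⟨ eq ⟩
    c * c + d * d                 ≡⟨ cong₂ _+_ c²≡ d²≡ ⟩
    1 + 8 * v + (1 + 8 * w)       ≡⟨ solve (v ∷ w ∷ []) ⟩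
    2 + (2 * v + 2 * w) * 4       ∎)) λ ()

  odd+odd≢square : ∀ {a b} c → Odd a → Odd b → a * a + b * b ≢ c * c
  odd+odd≢square {a} {b} c odd-a odd-b eq with even-or-odd c
  ... | inj₁ even-c = even+even≢odd+odd even-c (0 , refl) odd-a odd-b (trans (+-identityʳ _) (sym eq))
  ... | inj₂ odd-c with odd-square odd-a | odd-square odd-b | odd-square odd-c
  ...   | s , a²≡ | t , b²≡ | w , c²≡ = contradiction (residues 2 0 1 (1 + 4 * s + 4 * t) (4 * w) (begin
    (1 + 4 * s + 4 * t) * 2     ≡⟨ solve (s ∷ t ∷ []) ⟩
    1 + 8 * s + (1 + 8 * t)     ≡⟨ cong₂ _+_ a²≡ b²≡ ⟨
    a * a + b * b               ≡⟨ eq ⟩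
    c * c                       ≡⟨ c²≡ ⟩
    1 + 8 * w                   ≡⟨ solve (w ∷ []) ⟩
    1 + 4 * w * 2               ∎)) λ ()

  -- A common divisor divides u, so it is coprime to c; as it also divides c², it is 1.
  coprime-shift : ∀ {u s c} → Coprime u c → s * (u + s) ≡ c * c → Coprime s (u + s)
  coprime-shift {u} {s} {c} u⊥c eq {d} (d∣s , d∣u+s) =
    u⊥c (d∣u , coprime-divisor d⊥c (subst (d ∣_) eq (∣m⇒∣m*n (u + s) d∣s)))
    where
    d∣u : d ∣ u
    d∣u = ∣m+n∣m⇒∣n (subst (d ∣_) (+-comm u s) d∣u+s) d∣s
    d⊥c : Coprime d c
    d⊥c = coprime-∣ d∣u ∣-refl u⊥c

  -- The parametrisation of a primitive Pythagorean triple with odd leg u = y² - x² and even leg 2 c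
  -- = 2 x y: s and u + s are coprime with product c², so both are squares.
  legs : ∀ {u c} p → Odd u → Coprime u c → u * u + 4 * (c * c) ≡ p * p →
    ∃[ x ] ∃[ y ] u + x * x ≡ y * y × Coprime x y × c ≡ x * y
  legs {u} {c} p odd-u u⊥c eq with odd-square-difference p odd-u eq
  ... | s , _ , s[u+s]≡c² with coprime-product-squares s (u + s) c s⊥u+s s[u+s]≡c²
    where
    s⊥u+s : Coprime s (u + s)
    s⊥u+s = coprime-shift {c = c} u⊥c s[u+s]≡c²
  ... | x , y , refl , u+x²≡y² , c≡xy = x , y , u+x²≡y² , x⊥y , c≡xy
    where
    x⊥y : Coprime x y
    x⊥y = coprime-∣ (m∣m*n x) (subst (y ∣_) (sym u+x²≡y²) (m∣m*n y)) (coprime-shift {c = c} u⊥c s[u+s]≡c²)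

  cross : ∀ {u a b c d} → u + a ≡ b → u + c ≡ d → d + a ≡ b + c
  cross {u} {a} {b} {c} {d} refl refl = solve (u ∷ a ∷ c ∷ [])

  -- Here q = 2 h, so the triples have even legs 2 h and 8 h. Their parameters satisfy h = x y, 4 h
  -- = z w and w² + x² = y² + z². If the parities match, the odd parameter of each triple serves as
  -- m or k in `four-number-descent`, and the even ones as n and l.
  descend : ∀ {u h} p v → Odd u → Coprime u h →
    u * u + 4 * (h * h) ≡ p * p → u * u + 4 * (4 * h * (4 * h)) ≡ v * v →
    ∃[ n ] n ∣ h × ∃[ α ] ∃[ δ ] ∃[ β ] ∃[ γ ] Odd α × Coprime α δ × δ ∣ n ×
      α * α + δ * δ ≡ γ * γ × α * α + 16 * (δ * δ) ≡ β * β
  descend {u} {h} p v odd-u u⊥h eq₁ eq₂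
    with legs p odd-u u⊥h eq₁ | legs v odd-u (coprime-*ʳ {b = 4} (odd-coprime-4 odd-u) u⊥h) eq₂
  ... | x , y , u+x²≡y² , x⊥y , h≡xy | z , w , u+z²≡w² , _ , 4h≡zw
    with opposite-parity x y odd-u u+x²≡y² | opposite-parity z w odd-u u+z²≡w²
  ... | inj₁ (even-x , odd-y) | inj₁ (_ , odd-w) =
    x , subst (x ∣_) (sym h≡xy) (m∣m*n y) ,
    four-number-descent z odd-y odd-w (Coprime.sym x⊥y)
      (trans (*-comm w z) (trans (sym 4h≡zw) (cong (4 *_) (trans h≡xy (*-comm x y)))))
      (cross {u} {x * x} u+x²≡y² u+z²≡w²)
  ... | inj₂ (odd-x , _) | inj₂ (odd-z , _) =
    y , subst (y ∣_) (sym h≡xy) (n∣m*n x) ,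
    four-number-descent w odd-x odd-z x⊥y (trans (sym 4h≡zw) (cong (4 *_) h≡xy))
      (trans (+-comm (z * z) (y * y)) (trans (sym (cross {u} {x * x} u+x²≡y² u+z²≡w²)) (+-comm (w * w) (x * x))))
  -- With mismatched parities, one side of w² + x² = y² + z² is 0 and the other 2 modulo 4.
  ... | inj₁ (even-x , odd-y) | inj₂ (odd-z , even-w) =
    ⊥-elim (even+even≢odd+odd even-w even-x odd-y odd-z (cross {u} {x * x} u+x²≡y² u+z²≡w²))
  ... | inj₂ (odd-x , even-y) | inj₁ (even-z , odd-w) =
    ⊥-elim (even+even≢odd+odd even-y even-z odd-w odd-x (sym (cross {u} {x * x} u+x²≡y² u+z²≡w²)))

  -- With q = 0 both forms are squares for every u, so the descent can only conclude q = 0.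
  NoConcordant : ℕ → Set
  NoConcordant q = ∀ {u} p v → Odd u → Coprime u q →
    u * u + q * q ≡ p * p → u * u + 16 * (q * q) ≡ v * v → q ≡ 0

  even-concordant : ∀ h .{{_ : NonZero h}} → (∀ {r} → r < 2 * h → NoConcordant r) → ∀ {u} p v →
    Odd u → Coprime u (2 * h) →
    u * u + 2 * h * (2 * h) ≡ p * p → u * u + 16 * (2 * h * (2 * h)) ≡ v * v → ⊥
  even-concordant h rec {u} p v odd-u u⊥2h eq₁ eq₂
    with descend p v odd-u (coprime-∣ ∣-refl (n∣m*n 2) u⊥2h)
      (trans (cong (u * u +_) (double-square h)) eq₁)
      (trans (cong (u * u +_) (quadruple-square h)) eq₂)
    where
    double-square : ∀ h → 4 * (h * h) ≡ 2 * h * (2 * h)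
    double-square = solve-∀
    quadruple-square : ∀ h → 4 * (4 * h * (4 * h)) ≡ 16 * (2 * h * (2 * h))
    quadruple-square = solve-∀
  ... | n , n∣h , α , δ , β , γ , odd-α , α⊥δ , δ∣n , eq₁′ , eq₂′ =
    ≢-nonZero⁻¹ h (0∣⇒≡0 (subst (_∣ h) δ≡0 δ∣h))
    where
    δ∣h : δ ∣ h
    δ∣h = ∣-trans δ∣n n∣h
    -- δ divides h, which is below 2 h, so the induction hypothesis applies; δ = 0 would then force
    -- h = 0.
    δ≡0 : δ ≡ 0
    δ≡0 = rec (≤-<-trans (∣⇒≤ δ∣h) (subst (h <_) (*-comm h 2) (m<m*n h 2 (s≤s (s≤s z≤n)))))
      γ β odd-α α⊥δ eq₁′ eq₂′

  no-concordant : ∀ q → NoConcordant q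
  no-concordant = <-rec NoConcordant step
    where
    step : ∀ q → (∀ {r} → r < q → NoConcordant r) → NoConcordant q
    step q rec p v odd-u u⊥q eq₁ eq₂ with even-or-odd q
    ... | inj₂ odd-q = ⊥-elim (odd+odd≢square p odd-u odd-q eq₁)
    ... | inj₁ (h , refl) with h ≟ 0
    ...   | yes refl = refl
    ...   | no h≢0 = ⊥-elim (even-concordant h {{≢-nonZero h≢0}} rec p v odd-u u⊥q eq₁ eq₂)

  -- The quartic y² = (p² - q²)(p² + 15 q²)

  even-of-square : ∀ {a} → Even (a * a) → Even a
  even-of-square {a} even-a² with even-or-odd a
  ... | inj₁ even-a = even-a
  ... | inj₂ odd-a@(k , refl) = ⊥-elim (even-odd-⊥ even-a² (2 * k * (1 + k) , solve (k ∷ [])))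

  -- The left side is 2 or 3 modulo 4.
  square+2odd-square≢square : ∀ a {n} c → Odd n → a * a + 2 * (n * n) ≢ c * c
  square+2odd-square≢square a {n} c odd-n eq with even-or-odd a | even-or-odd c | odd-square odd-n
  ... | inj₁ even-a | inj₁ even-c | t , n²≡ with even-square even-a | even-square even-c
  ...   | s , a²≡ | w , c²≡ = contradiction (residues 4 2 0 (s + 4 * t) w (begin
    2 + (s + 4 * t) * 4            ≡⟨ solve (s ∷ t ∷ []) ⟩
    4 * s + 2 * (1 + 8 * t)        ≡⟨ cong₂ (λ x y → x + 2 * y) a²≡ n²≡ ⟨
    a * a + 2 * (n * n)            ≡⟨ eq ⟩
    c * c                          ≡⟨ c²≡ ⟩
    4 * w                          ≡⟨ *-comm 4 w ⟩
    w * 4                          ∎)) λ ()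
  square+2odd-square≢square a {n} c odd-n eq | inj₁ even-a | inj₂ odd-c | t , n²≡
    with even-square even-a | odd-square odd-c
  ...   | s , a²≡ | w , c²≡ = contradiction (residues 4 2 1 (s + 4 * t) (2 * w) (begin
    2 + (s + 4 * t) * 4            ≡⟨ solve (s ∷ t ∷ []) ⟩
    4 * s + 2 * (1 + 8 * t)        ≡⟨ cong₂ (λ x y → x + 2 * y) a²≡ n²≡ ⟨
    a * a + 2 * (n * n)            ≡⟨ eq ⟩
    c * c                          ≡⟨ c²≡ ⟩
    1 + 8 * w                      ≡⟨ solve (w ∷ []) ⟩
    1 + 2 * w * 4                  ∎)) λ ()
  square+2odd-square≢square a {n} c odd-n eq | inj₂ odd-a | inj₁ even-c | t , n²≡
    with odd-square odd-a | even-square even-c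
  ...   | s , a²≡ | w , c²≡ = contradiction (residues 4 3 0 (2 * s + 4 * t) w (begin
    3 + (2 * s + 4 * t) * 4        ≡⟨ solve (s ∷ t ∷ []) ⟩
    1 + 8 * s + 2 * (1 + 8 * t)    ≡⟨ cong₂ (λ x y → x + 2 * y) a²≡ n²≡ ⟨
    a * a + 2 * (n * n)            ≡⟨ eq ⟩
    c * c                          ≡⟨ c²≡ ⟩
    4 * w                          ≡⟨ *-comm 4 w ⟩
    w * 4                          ∎)) λ ()
  square+2odd-square≢square a {n} c odd-n eq | inj₂ odd-a | inj₂ odd-c | t , n²≡
    with odd-square odd-a | odd-square odd-c
  ...   | s , a²≡ | w , c²≡ = contradiction (residues 4 3 1 (2 * s + 4 * t) (2 * w) (begin
    3 + (2 * s + 4 * t) * 4        ≡⟨ solve (s ∷ t ∷ []) ⟩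
    1 + 8 * s + 2 * (1 + 8 * t)    ≡⟨ cong₂ (λ x y → x + 2 * y) a²≡ n²≡ ⟨
    a * a + 2 * (n * n)            ≡⟨ eq ⟩
    c * c                          ≡⟨ c²≡ ⟩
    1 + 8 * w                      ≡⟨ solve (w ∷ []) ⟩
    1 + 2 * w * 4                  ∎)) λ ()

  -- w² = s (q + s), and since q is odd one of the two factors is even.
  odd-even-leg : ∀ {q} w p → Odd q → q * q + 4 * (w * w) ≡ p * p → Even w
  odd-even-leg {q} w p odd-q eq with odd-square-difference p odd-q eq
  ... | s , _ , s[q+s]≡w² with even-or-odd s
  ...   | inj₁ (k , refl) = even-of-square (k * (q + 2 * k) , trans (sym s[q+s]≡w²) (*-assoc 2 k _))
  odd-even-leg w p (j , refl) eq | s , _ , s[q+s]≡w² | inj₂ (k , refl) =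
    even-of-square ((1 + 2 * k) * (1 + j + k) , trans (sym s[q+s]≡w²) (solve (j ∷ k ∷ [])))

  square-scaled : ∀ {a} k c .{{_ : NonZero k}} → k * k * a ≡ c * c → ∃[ d ] c ≡ d * k × a ≡ d * d
  square-scaled {a} k c eq with square-∣⇒∣ k c (subst (k * k ∣_) eq (m∣m*n a))
  ... | divides d refl = d , refl , *-cancelˡ-≡ _ _ (k * k) {{m*n≢0 k k}} (trans eq (solve (d ∷ k ∷ [])))

  sum-of-squares-coprime : ∀ {u p q} → Coprime p q → q * q + u * u ≡ p * p → Coprime q u
  sum-of-squares-coprime {u} {p} {q} p⊥q eq {d} (d∣q , d∣u) =
    p⊥q (coprime-divisor d⊥p d∣p² , d∣q)
    where
    d⊥p : Coprime d p
    d⊥p = coprime-∣ d∣q ∣-refl (Coprime.sym p⊥q)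
    d∣p² : d ∣ p * p
    d∣p² = subst (d ∣_) eq (∣m∣n⇒∣m+n (∣m⇒∣m*n q d∣q) (∣m⇒∣m*n u d∣u))

  double-square : ∀ {u} w → u ≡ 2 * w → u * u ≡ 4 * (w * w)
  double-square w refl = solve (w ∷ [])

  quadruple-square : ∀ {u} w x → u ≡ 2 * w → w ≡ 2 * x → u * u ≡ 16 * (x * x)
  quadruple-square w x u≡2w w≡2x =
    trans (double-square w u≡2w) (trans (cong (4 *_) (double-square x w≡2x)) (regroup (x * x)))
    where
    regroup : ∀ a → 4 * (4 * a) ≡ 16 * a
    regroup = solve-∀

  -- Dividing u = 4 x out of u² + 16 q² = v² swaps the roles of the two forms.
  swapped-case : ∀ {q} p x v → Odd q → Coprime q x →
    q * q + 16 * (x * x) ≡ p * p → 16 * (x * x) + 16 * (q * q) ≡ v * v → x ≡ 0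
  swapped-case {q} p x v odd-q q⊥x eq₁ eq₂ =
    case square-scaled 4 v (trans (regroup (q * q) (x * x)) eq₂) of λ where
      (d , _ , q²+x²≡d²) → no-concordant x d p odd-q q⊥x q²+x²≡d² eq₁
    where
    regroup : ∀ a b → 4 * 4 * (a + b) ≡ 16 * b + 16 * a
    regroup = solve-∀

  -- If u is odd, (u , q) is a concordant pair with q ≠ 0. Coprimality excludes that u and q are
  -- both even. Otherwise q is the odd leg, the even leg u is a multiple 4 x, and (q , x) is
  -- concordant.
  square-case : ∀ {p q} .{{_ : NonZero q}} u v → Coprime p q →
    q * q + u * u ≡ p * p → u * u + 16 * (q * q) ≡ v * v → u ≡ 0
  square-case {p} {q} u v p⊥q eq₁ eq₂ with even-or-odd u | even-or-odd q
  ... | inj₂ odd-u | _ = ⊥-elim (≢-nonZero⁻¹ q (no-concordant q p v odd-u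
        (Coprime.sym (sum-of-squares-coprime {u} {p} p⊥q eq₁)) (trans (+-comm (u * u) (q * q)) eq₁) eq₂))
  ... | inj₁ even-u | inj₁ even-q =
    ⊥-elim (evens-not-coprime even-q even-u (sum-of-squares-coprime {u} {p} p⊥q eq₁))
  ... | inj₁ (w , u≡2w) | inj₂ odd-q
    with odd-even-leg w p odd-q (trans (cong (q * q +_) (sym (double-square w u≡2w))) eq₁)
  ... | x , w≡2x = trans u≡2w (cong (2 *_) (trans w≡2x (cong (2 *_) x≡0)))
    where
    x∣u : x ∣ u
    x∣u = ∣-trans (subst (x ∣_) (sym w≡2x) (n∣m*n 2)) (subst (w ∣_) (sym u≡2w) (n∣m*n 2))
    u²≡16x² : u * u ≡ 16 * (x * x)
    u²≡16x² = quadruple-square w x u≡2w w≡2x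
    x≡0 : x ≡ 0
    x≡0 = swapped-case p x v odd-q (coprime-∣ ∣-refl x∣u (sum-of-squares-coprime {u} {p} p⊥q eq₁))
      (trans (cong (q * q +_) (sym u²≡16x²)) eq₁)
      (trans (cong (_+ 16 * (q * q)) (sym u²≡16x²)) eq₂)

  -- For odd u the first equation fails modulo 4. For even u and q also p is even. For even u and
  -- odd q, the second equation divided by 4 has the same shape as the first and fails likewise.
  twice-square-case : ∀ {p q} u v → Coprime p q →
    q * q + 2 * (u * u) ≡ p * p → u * u + 8 * (q * q) ≢ v * v
  twice-square-case {p} {q} u v p⊥q eq₁ eq₂ with even-or-odd u | even-or-odd q
  ... | inj₂ odd-u | _ = square+2odd-square≢square q p odd-u eq₁
  ... | inj₁ _ | inj₁ even-q@(x , q≡2x) = evens-not-coprime even-p even-q p⊥q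
    where
    regroup : ∀ a b → 4 * a + 2 * b ≡ 2 * (2 * a + b)
    regroup = solve-∀
    even-p : Even p
    even-p = even-of-square (2 * (x * x) + u * u , trans (sym eq₁)
      (trans (cong (_+ 2 * (u * u)) (double-square x q≡2x)) (regroup (x * x) (u * u))))
  ... | inj₁ (w , u≡2w) | inj₂ odd-q =
    case square-scaled 2 v
      (trans (regroup (w * w) (q * q)) (trans (cong (_+ 8 * (q * q)) (sym (double-square w u≡2w))) eq₂)) of λ where
      (d , _ , w²+2q²≡d²) → square+2odd-square≢square w d odd-q w²+2q²≡d²
    where
    regroup : ∀ a b → 2 * 2 * (a + 2 * b) ≡ 4 * a + 8 * b
    regroup = solve-∀

  square-or-twice-square-divisor-of-16 : ∀ {g} → g < 17 → g ∣ 16 →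
    g ≡ 1 ⊎ g ≡ 4 ⊎ g ≡ 16 ⊎ g ≡ 2 ⊎ g ≡ 8
  square-or-twice-square-divisor-of-16 = from-yes (allUpTo?
    (λ g → g ∣? 16 →-dec (g ≟ 1 ⊎-dec g ≟ 4 ⊎-dec g ≟ 16 ⊎-dec g ≟ 2 ⊎-dec g ≟ 8)) 17)

  -- The square j² can be absorbed into the cofactors, so only the ratios 1 and 2 remain to be
  -- treated.
  divisors-of-16 : ∀ {g} → g ∣ 16 → ∃[ j ] (g ≡ j * j ⊎ g ≡ 2 * (j * j))
  divisors-of-16 g∣16 with square-or-twice-square-divisor-of-16 (s≤s (∣⇒≤ g∣16)) g∣16
  ... | inj₁ refl = 1 , inj₁ refl
  ... | inj₂ (inj₁ refl) = 2 , inj₁ refl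
  ... | inj₂ (inj₂ (inj₁ refl)) = 4 , inj₁ refl
  ... | inj₂ (inj₂ (inj₂ (inj₁ refl))) = 1 , inj₂ refl
  ... | inj₂ (inj₂ (inj₂ (inj₂ refl))) = 2 , inj₂ refl

  product-square-ratio : ∀ {P Q e} T .{{_ : NonZero P}} .{{_ : NonZero e}} → e * e * (P * Q) ≡ T * T →
    ∃[ g ] ∃[ s ] ∃[ t ] P ≡ s * s * g × Q ≡ t * t * g
  product-square-ratio {P} {Q} {e} T eq with gcd-split P Q
  ... | g , P′ , Q′ , g≢0 , refl , refl , P′⊥Q′ =
    case square-scaled (e * g) T {{m*n≢0 e g {{it}} {{g≢0}}}} (trans (regroup P′ Q′ e g) eq) of λ where
      (d , _ , P′Q′≡d²) → case coprime-product-squares P′ Q′ d P′⊥Q′ P′Q′≡d² of λ where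
        (s , t , P′≡s² , Q′≡t² , _) → g , s , t , cong (_* g) P′≡s² , cong (_* g) Q′≡t²
    where
    regroup : ∀ P Q e g → e * g * (e * g) * (P * Q) ≡ e * e * (P * g * (Q * g))
    regroup = solve-∀

  square-ratio-case : ∀ {p q} P s t j .{{_ : NonZero q}} .{{_ : NonZero P}} → Coprime p q →
    q * q + P ≡ p * p → P ≡ s * s * (j * j) → P + 16 * (q * q) ≢ t * t * (j * j)
  square-ratio-case {p} {q} P s t j p⊥q p²≡ P≡ Q≡ =
    ≢-nonZero⁻¹ P (trans P≡′ (cong (λ x → x * x) sj≡0))
    where
    regroup : ∀ s j → s * s * (j * j) ≡ s * j * (s * j)
    regroup = solve-∀
    P≡′ : P ≡ s * j * (s * j)
    P≡′ = trans P≡ (regroup s j)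
    sj≡0 : s * j ≡ 0
    sj≡0 = square-case (s * j) (t * j) p⊥q
      (trans (cong (q * q +_) (sym P≡′)) p²≡)
      (trans (cong (_+ 16 * (q * q)) (sym P≡′)) (trans Q≡ (regroup t j)))

  twice-square-ratio-case : ∀ {p q} P s t j → Coprime p q →
    q * q + P ≡ p * p → P ≡ s * s * (2 * (j * j)) → P + 16 * (q * q) ≢ t * t * (2 * (j * j))
  twice-square-ratio-case {p} {q} P s t j p⊥q p²≡ P≡ Q≡ = twice-square-case (s * j) (t * j) p⊥q
    (trans (cong (q * q +_) (sym P≡′)) p²≡)
    (*-cancelˡ-≡ _ _ 2 (begin
      2 * (s * j * (s * j) + 8 * (q * q))       ≡⟨ expand (s * j * (s * j)) (q * q) ⟩
      2 * (s * j * (s * j)) + 16 * (q * q)      ≡⟨ cong (_+ 16 * (q * q)) P≡′ ⟨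
      P + 16 * (q * q)                          ≡⟨ trans Q≡ (regroup t j) ⟩
      2 * (t * j * (t * j))                     ∎))
    where
    regroup : ∀ s j → s * s * (2 * (j * j)) ≡ 2 * (s * j * (s * j))
    regroup = solve-∀
    P≡′ : P ≡ 2 * (s * j * (s * j))
    P≡′ = trans P≡ (regroup s j)
    expand : ∀ a b → 2 * (a + 8 * b) ≡ 2 * a + 16 * b
    expand = solve-∀

  -- g divides the difference 16 q², hence also 16 p² = 16 q² + 16 P, and p² and q² are coprime.
  ratio-∣16 : ∀ {p q g P} → Coprime p q → q * q + P ≡ p * p → g ∣ P → g ∣ P + 16 * (q * q) → g ∣ 16
  ratio-∣16 {p} {q} {g} {P} p⊥q p²≡ g∣P g∣Q =
    coprime-factors (coprime-squares p⊥q) (g∣p²16 , g∣q²16)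
    where
    g∣q²16 : g ∣ q * q * 16
    g∣q²16 = subst (g ∣_) (*-comm 16 (q * q)) (∣m+n∣m⇒∣n g∣Q g∣P)
    g∣p²16 : g ∣ p * p * 16
    g∣p²16 = subst (λ x → g ∣ x * 16) p²≡
      (subst (g ∣_) (sym (*-distribʳ-+ 16 (q * q) P)) (∣m∣n⇒∣m+n g∣q²16 (∣m⇒∣m*n 16 g∣P)))

  difference-case : ∀ {p q e} P T .{{_ : NonZero q}} .{{_ : NonZero P}} .{{_ : NonZero e}} → Coprime p q →
    q * q + P ≡ p * p → e * e * (P * (P + 16 * (q * q))) ≢ T * T
  difference-case {p} {q} {e} P T p⊥q p²≡ eq =
    case product-square-ratio {P} {e = e} T eq of λ where
      (g , s , t , P≡ , Q≡) →
        case divisors-of-16 (ratio-∣16 {p} p⊥q p²≡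
               (subst (g ∣_) (sym P≡) (n∣m*n (s * s))) (subst (g ∣_) (sym Q≡) (n∣m*n (t * t)))) of λ where
          (j , inj₁ g≡) → square-ratio-case {p} P s t j p⊥q p²≡
            (trans P≡ (cong (s * s *_) g≡)) (trans Q≡ (cong (t * t *_) g≡))
          (j , inj₂ g≡) → twice-square-ratio-case {p} P s t j p⊥q p²≡
            (trans P≡ (cong (s * s *_) g≡)) (trans Q≡ (cong (t * t *_) g≡))

  -- A subtraction-free form of T² = e² (p² - q²)(p² + 15 q²), where T / e stands for y. For p < q
  -- the right side stays below 15 e² q⁴.
  quartic-solutions : ∀ {p q e} T .{{_ : NonZero q}} .{{_ : NonZero e}} → Coprime p q →
    T * T + 15 * (e * e * (q * q * (q * q))) ≡ e * e * (p * p * (p * p + 14 * (q * q))) → p ≡ q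
  quartic-solutions {p} {q} {e} T p⊥q eq with p <? q
  ... | yes p<q = ⊥-elim (<⇒≱ (*-monoʳ-< (e * e) {{m*n≢0 e e}} p²[p²+14q²]<q²[q²+14q²])
      (subst (_≤ e * e * (p * p * (p * p + 14 * (q * q)))) (expand (e * e) (q * q))
        (subst (15 * (e * e * (q * q * (q * q))) ≤_) eq (m≤n+m _ (T * T)))))
    where
    p²<q² : p * p < q * q
    p²<q² = *-mono-< p<q p<q
    p²[p²+14q²]<q²[q²+14q²] : p * p * (p * p + 14 * (q * q)) < q * q * (q * q + 14 * (q * q))
    p²[p²+14q²]<q²[q²+14q²] = *-mono-< p²<q² (+-monoˡ-< (14 * (q * q)) p²<q²)
    expand : ∀ e q → 15 * (e * (q * q)) ≡ e * (q * (q + 14 * q))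
    expand = solve-∀
  ... | no p≮q with m≤n⇒∃[o]m+o≡n (*-mono-≤ (≮⇒≥ p≮q) (≮⇒≥ p≮q))
  ...   | P , q²+P≡p² with P ≟ 0
  ...     | yes refl = sym (square-injective q p (trans (sym (+-identityʳ _)) q²+P≡p²))
  ...     | no P≢0 = ⊥-elim (difference-case {e = e} P T {{it}} {{≢-nonZero P≢0}} p⊥q q²+P≡p² (
    +-cancelʳ-≡ (15 * (e * e * (q * q * (q * q)))) _ _ (begin
      e * e * (P * (P + 16 * (q * q))) + 15 * (e * e * (q * q * (q * q)))   ≡⟨ expand P (q * q) (e * e) ⟩
      e * e * ((q * q + P) * ((q * q + P) + 14 * (q * q)))                  ≡⟨ cong (λ x → e * e * (x * (x + 14 * (q * q)))) q²+P≡p² ⟩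
      e * e * (p * p * (p * p + 14 * (q * q)))                              ≡⟨ eq ⟨
      T * T + 15 * (e * e * (q * q * (q * q)))                              ∎)))
    where
    expand : ∀ P q e → e * (P * (P + 16 * q)) + 15 * (e * (q * q)) ≡ e * ((q + P) * ((q + P) + 14 * q))
    expand = solve-∀

-- Clearing denominators in the quartic

module RationalPoints where
  open import Data.Integer.Base using (+_)

  square≡+∣∣² : ∀ i → i ℤ.* i ≡ + (ℤ.∣ i ∣ ℕ.* ℤ.∣ i ∣)
  square≡+∣∣² (+ n)       = sym (ℤ.pos-* n n)
  square≡+∣∣² ℤ.-[1+ n ] = refl

  -- The factors 1 are the denominators of 14 and 15, left by cross-multiplying unnormalised
  -- fractions. Only squares of a and n occur, so absolute values suffice.
  integral-quartic : ∀ a n b d →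
    (a ℤ.* a ℤ.* + 1 ℤ.+ + 15 ℤ.* + (b ℕ.* b)) ℤ.* + (d ℕ.* d ℕ.* (d ℕ.* d ℕ.* 1)) ≡
      n ℤ.* n ℤ.* (n ℤ.* n ℤ.* + 1 ℤ.+ + 14 ℤ.* + (d ℕ.* d)) ℤ.* + (b ℕ.* b ℕ.* 1) →
    let A = ℤ.∣ a ∣; N = ℤ.∣ n ∣ in
    (A ℕ.* A ℕ.+ 15 ℕ.* (b ℕ.* b)) ℕ.* (d ℕ.* d ℕ.* (d ℕ.* d)) ≡
      N ℕ.* N ℕ.* (N ℕ.* N ℕ.+ 14 ℕ.* (d ℕ.* d)) ℕ.* (b ℕ.* b)
  integral-quartic a n b d eq
    rewrite square≡+∣∣² a | square≡+∣∣² n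
          | ℤ.*-identityʳ (+ (ℤ.∣ a ∣ ℕ.* ℤ.∣ a ∣)) | ℤ.*-identityʳ (+ (ℤ.∣ n ∣ ℕ.* ℤ.∣ n ∣))
          | ℕ.*-identityʳ (d ℕ.* d) | ℕ.*-identityʳ (b ℕ.* b)
          | sym (ℤ.pos-* 15 (b ℕ.* b)) | sym (ℤ.pos-* 14 (d ℕ.* d))
          | sym (ℤ.pos-* (ℤ.∣ a ∣ ℕ.* ℤ.∣ a ∣ ℕ.+ 15 ℕ.* (b ℕ.* b)) (d ℕ.* d ℕ.* (d ℕ.* d)))
          | sym (ℤ.pos-* (ℤ.∣ n ∣ ℕ.* ℤ.∣ n ∣) (ℤ.∣ n ∣ ℕ.* ℤ.∣ n ∣ ℕ.+ 14 ℕ.* (d ℕ.* d)))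
          | sym (ℤ.pos-* (ℤ.∣ n ∣ ℕ.* ℤ.∣ n ∣ ℕ.* (ℤ.∣ n ∣ ℕ.* ℤ.∣ n ∣ ℕ.+ 14 ℕ.* (d ℕ.* d))) (b ℕ.* b))
    = ℤ.+-injective eq

  14ℚ 15ℚ : ℚ
  14ℚ = + 14 ℚ./ 1
  15ℚ = + 15 ℚ./ 1

  toℚᵘ-quartic : ∀ m y → y ℚ.* y ℚ.+ 15ℚ ≡ m ℚ.* m ℚ.* (m ℚ.* m ℚ.+ 14ℚ) →
    toℚᵘ y ℚᵘ.* toℚᵘ y ℚᵘ.+ toℚᵘ 15ℚ ≃ toℚᵘ m ℚᵘ.* toℚᵘ m ℚᵘ.* (toℚᵘ m ℚᵘ.* toℚᵘ m ℚᵘ.+ toℚᵘ 14ℚ)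
  toℚᵘ-quartic m y eq = begin
    toℚᵘ y ℚᵘ.* toℚᵘ y ℚᵘ.+ toℚᵘ 15ℚ                                 ≈⟨ square+ y 15ℚ ⟨
    toℚᵘ (y ℚ.* y ℚ.+ 15ℚ)                                           ≡⟨ cong toℚᵘ eq ⟩
    toℚᵘ (m ℚ.* m ℚ.* (m ℚ.* m ℚ.+ 14ℚ))                             ≈⟨ ℚ.toℚᵘ-homo-* (m ℚ.* m) (m ℚ.* m ℚ.+ 14ℚ) ⟩
    toℚᵘ (m ℚ.* m) ℚᵘ.* toℚᵘ (m ℚ.* m ℚ.+ 14ℚ)                       ≈⟨ ℚᵘ.*-cong (ℚ.toℚᵘ-homo-* m m) (square+ m 14ℚ) ⟩
    toℚᵘ m ℚᵘ.* toℚᵘ m ℚᵘ.* (toℚᵘ m ℚᵘ.* toℚᵘ m ℚᵘ.+ toℚᵘ 14ℚ)       ∎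
    where
    open import Relation.Binary.Reasoning.Setoid ℚᵘ.≃-setoid
    square+ : ∀ x c → toℚᵘ (x ℚ.* x ℚ.+ c) ≃ toℚᵘ x ℚᵘ.* toℚᵘ x ℚᵘ.+ toℚᵘ c
    square+ x c = ℚᵘ.≃-trans (ℚ.toℚᵘ-homo-+ (x ℚ.* x) c) (ℚᵘ.+-congˡ (toℚᵘ c) (ℚ.toℚᵘ-homo-* x x))

  -- y² + 15 = m² (m² + 14) is y² = (m² - 1)(m² + 15).
  rational-quartic : ∀ m y → y ℚ.* y ℚ.+ 15ℚ ≡ m ℚ.* m ℚ.* (m ℚ.* m ℚ.+ 14ℚ) → m ℚ.* m ≡ 1ℚ
  rational-quartic m@(mkℚ n d-1 n⊥d) y@(mkℚ a b-1 _) eq = helper (toℚᵘ-quartic m y eq)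
    where
    b d A N : ℕ
    b = suc b-1
    d = suc d-1
    A = ℤ.∣ a ∣
    N = ℤ.∣ n ∣
    unit : N ≡ d → m ℚ.* m ≡ 1ℚ
    unit N≡d = ℚ.toℚᵘ-injective (ℚᵘ.≃-trans (ℚ.toℚᵘ-homo-* m m) (*≡* (begin
      n ℤ.* n ℤ.* + 1       ≡⟨ ℤ.*-identityʳ _ ⟩
      n ℤ.* n               ≡⟨ square≡+∣∣² n ⟩
      + (N ℕ.* N)           ≡⟨ cong₂ (λ i j → + (i ℕ.* j)) N≡d N≡d ⟩
      + (d ℕ.* d)           ≡⟨ ℤ.*-identityˡ _ ⟨
      + 1 ℤ.* + (d ℕ.* d)   ∎)))
      where open ≡-Reasoning
    regroupˡ : ∀ A b d → A ℕ.* d ℕ.* (A ℕ.* d) ℕ.+ 15 ℕ.* (b ℕ.* (d ℕ.* d)) ≡ (A ℕ.* A ℕ.+ 15 ℕ.* b) ℕ.* (d ℕ.* d)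
    regroupˡ = ℕ-Solver.solve-∀
    helper : toℚᵘ y ℚᵘ.* toℚᵘ y ℚᵘ.+ toℚᵘ 15ℚ ≃
      toℚᵘ m ℚᵘ.* toℚᵘ m ℚᵘ.* (toℚᵘ m ℚᵘ.* toℚᵘ m ℚᵘ.+ toℚᵘ 14ℚ) → m ℚ.* m ≡ 1ℚ
    -- For y = a / b and m = n / d, multiplying by b² d⁴ gives T = A d² and e = b.
    helper (*≡* eq′) = unit (QuarticDescent.quartic-solutions {e = b} (A ℕ.* (d ℕ.* d)) (Coprime.recompute n⊥d) (begin
      A ℕ.* (d ℕ.* d) ℕ.* (A ℕ.* (d ℕ.* d)) ℕ.+ 15 ℕ.* (b ℕ.* b ℕ.* (d ℕ.* d ℕ.* (d ℕ.* d)))   ≡⟨ regroupˡ A (b ℕ.* b) (d ℕ.* d) ⟩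
      (A ℕ.* A ℕ.+ 15 ℕ.* (b ℕ.* b)) ℕ.* (d ℕ.* d ℕ.* (d ℕ.* d))      ≡⟨ integral-quartic a n b d eq′ ⟩
      N ℕ.* N ℕ.* (N ℕ.* N ℕ.+ 14 ℕ.* (d ℕ.* d)) ℕ.* (b ℕ.* b)        ≡⟨ ℕ.*-comm _ (b ℕ.* b) ⟩
      b ℕ.* b ℕ.* (N ℕ.* N ℕ.* (N ℕ.* N ℕ.+ 14 ℕ.* (d ℕ.* d)))        ∎))
      where open ≡-Reasoning

-- The coefficient equations over the rationals

module Factorisation where
  open RationalPoints using (14ℚ; 15ℚ; rational-quartic)
  open import Data.Integer.Base using (+_)
  open import Data.Rational.Base
  open import Data.Rational.Properties
  open ≡-Reasoning

  ℚ-ring : AlmostCommutativeRing 0ℓ 0ℓ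
  ℚ-ring = fromCommutativeRing +-*-commutativeRing λ p → case 0ℚ ≟ p of λ where
    (yes 0≡p) → just 0≡p
    (no _)    → nothing

  2ℚ 4ℚ 64ℚ : ℚ
  2ℚ = + 2 / 1
  4ℚ = + 4 / 1
  64ℚ = + 64 / 1

  product≡0 : ∀ p q → p * q ≡ 0ℚ → p ≡ 0ℚ ⊎ q ≡ 0ℚ
  product≡0 p q pq≡0 with p ≟ 0ℚ
  ... | yes p≡0 = inj₁ p≡0
  ... | no p≢0 = inj₂ (begin
    q                ≡⟨ *-identityˡ q ⟨
    1ℚ * q           ≡⟨ cong (_* q) (*-inverseˡ p) ⟨
    1/ p * p * q     ≡⟨ *-assoc (1/ p) p q ⟩
    1/ p * (p * q)   ≡⟨ cong (1/ p *_) pq≡0 ⟩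
    1/ p * 0ℚ        ≡⟨ *-zeroʳ (1/ p) ⟩
    0ℚ               ∎)
    where instance _ = ≢-nonZero p≢0

  square≡0 : ∀ p → p * p ≡ 0ℚ → p ≡ 0ℚ
  square≡0 p p²≡0 = reduce (product≡0 p p p²≡0)

  -- Dehomogenise: (p / q , y / q²) is a point on the affine quartic.
  homogeneous-quartic : ∀ p q y → q ≢ 0ℚ →
    y * y + 15ℚ * (q * q * (q * q)) ≡ p * p * (p * p + 14ℚ * (q * q)) → p * p ≡ q * q
  homogeneous-quartic p q y q≢0 eq = begin
    p * p                                 ≡⟨ *-identityʳ (p * p) ⟨
    p * p * 1ℚ                            ≡⟨ cong (λ e → p * p * (e * e)) qi≡1 ⟨
    p * p * (q * i * (q * i))             ≡⟨ regroup p q i ⟩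
    p * i * (p * i) * (q * q)             ≡⟨ cong (_* (q * q)) [pi]²≡1 ⟩
    1ℚ * (q * q)                          ≡⟨ *-identityˡ (q * q) ⟩
    q * q                                 ∎
    where
    instance _ = ≢-nonZero q≢0
    i : ℚ
    i = 1/ q
    qi≡1 : q * i ≡ 1ℚ
    qi≡1 = *-inverseʳ q
    regroup : ∀ p q i → p * p * (q * i * (q * i)) ≡ p * i * (p * i) * (q * q)
    regroup = RingSolver.solve-∀ ℚ-ring
    scaleˡ : ∀ y q i → y * (i * i) * (y * (i * i)) + 15ℚ * (q * i * (q * i) * (q * i * (q * i)))
      ≡ (y * y + 15ℚ * (q * q * (q * q))) * (i * i * (i * i))
    scaleˡ = RingSolver.solve-∀ ℚ-ring
    scaleʳ : ∀ p q i → p * p * (p * p + 14ℚ * (q * q)) * (i * i * (i * i))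
      ≡ p * i * (p * i) * (p * i * (p * i) + 14ℚ * (q * i * (q * i)))
    scaleʳ = RingSolver.solve-∀ ℚ-ring
    [pi]²≡1 : p * i * (p * i) ≡ 1ℚ
    [pi]²≡1 = rational-quartic (p * i) (y * (i * i)) (begin
      y * (i * i) * (y * (i * i)) + 15ℚ
        ≡⟨ cong (λ e → y * (i * i) * (y * (i * i)) + 15ℚ * (e * e * (e * e))) qi≡1 ⟨
      y * (i * i) * (y * (i * i)) + 15ℚ * (q * i * (q * i) * (q * i * (q * i)))
        ≡⟨ scaleˡ y q i ⟩
      (y * y + 15ℚ * (q * q * (q * q))) * (i * i * (i * i))
        ≡⟨ cong (_* (i * i * (i * i))) eq ⟩
      p * p * (p * p + 14ℚ * (q * q)) * (i * i * (i * i))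
        ≡⟨ scaleʳ p q i ⟩
      p * i * (p * i) * (p * i * (p * i) + 14ℚ * (q * i * (q * i)))
        ≡⟨ cong (λ e → p * i * (p * i) * (p * i * (p * i) + 14ℚ * (e * e))) qi≡1 ⟩
      p * i * (p * i) * (p * i * (p * i) + 14ℚ) ∎)

  -- With p = A - C, q = A + C and y = 4 (2 b - 2 A² - A C), this says
  -- y² = (p² - q²)(p² + 15 q²) modulo the coefficient of x.
  discriminant : ∀ A b C →
    4ℚ * (2ℚ * b + - (2ℚ * (A * A) + A * C)) * (4ℚ * (2ℚ * b + - (2ℚ * (A * A) + A * C)))
      + 15ℚ * ((A + C) * (A + C) * ((A + C) * (A + C)))
    ≡ (A + - C) * (A + - C) * ((A + - C) * (A + - C) + 14ℚ * ((A + C) * (A + C)))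
      + - (64ℚ * (b * (A * A + A * C + C * C + - b) + - ((A + C) * (A * (A * A + A * C + C * C + - b) + C * b))))
  discriminant = RingSolver.solve-∀ ℚ-ring

  -- If A = 0 then b² = 0, and if C = 0 then d² = 0.
  A≡0-case : ∀ {A b C} → A ≡ 0ℚ → let d = A * A + A * C + C * C + - b in
    b * d + - ((A + C) * (A * d + C * b)) ≡ 0ℚ → b * d ≡ 0ℚ
  A≡0-case {b = b} {C} refl e₁≡0 =
    trans (cong (_* d) (square≡0 b b²≡0)) (*-zeroˡ d)
    where
    d : ℚ
    d = 0ℚ * 0ℚ + 0ℚ * C + C * C + - b
    expand : ∀ b C → let d = 0ℚ * 0ℚ + 0ℚ * C + C * C + - b in
      b * b ≡ - (b * d + - ((0ℚ + C) * (0ℚ * d + C * b)))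
    expand = RingSolver.solve-∀ ℚ-ring
    b²≡0 : b * b ≡ 0ℚ
    b²≡0 = trans (expand b C) (cong -_ e₁≡0)

  C≡0-case : ∀ {A b C} → C ≡ 0ℚ → let d = A * A + A * C + C * C + - b in
    b * d + - ((A + C) * (A * d + C * b)) ≡ 0ℚ → b * d ≡ 0ℚ
  C≡0-case {A} {b} refl e₁≡0 = trans (cong (b *_) (square≡0 _ d²≡0)) (*-zeroʳ b)
    where
    expand : ∀ A b → let d = A * A + A * 0ℚ + 0ℚ * 0ℚ + - b in
      d * d ≡ - (b * d + - ((A + 0ℚ) * (A * d + 0ℚ * b)))
    expand = RingSolver.solve-∀ ℚ-ring
    d²≡0 : let d = A * A + A * 0ℚ + 0ℚ * 0ℚ + - b in d * d ≡ 0ℚ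
    d²≡0 = trans (expand A b) (cong -_ e₁≡0)

  reduced-case : ∀ A b C → let d = A * A + A * C + C * C + - b in
    b * d + - ((A + C) * (A * d + C * b)) ≡ 0ℚ → A + C ≡ 0ℚ ⊎ b * d ≡ 0ℚ
  reduced-case A b C e₁≡0 with A + C ≟ 0ℚ
  ... | yes q≡0 = inj₁ q≡0
  ... | no q≢0 = inj₂ (case product≡0 A C AC≡0 of λ where
      (inj₁ A≡0) → A≡0-case {A} {b} {C} A≡0 e₁≡0
      (inj₂ C≡0) → C≡0-case {A} {b} {C} C≡0 e₁≡0)
    where
    d p q y : ℚ
    d = A * A + A * C + C * C + - b
    p = A + - C
    q = A + C
    y = 4ℚ * (2ℚ * b + - (2ℚ * (A * A) + A * C))
    p²≡q² : p * p ≡ q * q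
    p²≡q² = homogeneous-quartic p q y q≢0 (trans (discriminant A b C) (trans
      (cong (λ e → p * p * (p * p + 14ℚ * (q * q)) + - (64ℚ * e)) e₁≡0) (+-identityʳ _)))
    polarise : ∀ A C → 4ℚ * (A * C) ≡ (A + C) * (A + C) + - ((A + - C) * (A + - C))
    polarise = RingSolver.solve-∀ ℚ-ring
    AC≡0 : A * C ≡ 0ℚ
    AC≡0 = case product≡0 4ℚ (A * C) (trans (polarise A C) (trans
        (cong (λ x → q * q + - x) p²≡q²) (+-inverseʳ (q * q)))) of λ where
      -- The other alternative, `4ℚ ≡ 0ℚ`, is refuted by evaluation.
      (inj₂ eq) → eq

  -- Either alternative of `reduced-case` annihilates R b d: A + C = 0 through R, the other through
  -- b d.
  monic-factors : ∀ R A b C d → R + (A + C) ≡ 0ℚ → b + d + A * C + R * (A + C) ≡ 0ℚ →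
    b * d + R * (A * d + C * b) ≡ 0ℚ → R * (b * d) ≡ 0ℚ
  monic-factors R A b C d e₄ e₃ e₁ = case reduced-case A b C e₁′ of λ where
      (inj₁ q≡0)  → trans (cong (_* (b * d)) (trans R≡-q (cong -_ q≡0))) (*-zeroˡ (b * d))
      (inj₂ bd≡0) → trans (cong (λ d → R * (b * d)) d≡) (trans (cong (R *_) bd≡0) (*-zeroʳ R))
    where
    isolate-R : ∀ R q → R ≡ (R + q) + - q
    isolate-R = RingSolver.solve-∀ ℚ-ring
    R≡-q : R ≡ - (A + C)
    R≡-q = trans (isolate-R R (A + C)) (trans (cong (_+ - (A + C)) e₄) (+-identityˡ (- (A + C))))
    isolate-d : ∀ A b C d → d ≡ (b + d + A * C + - (A + C) * (A + C)) + (A * A + A * C + C * C + - b)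
    isolate-d = RingSolver.solve-∀ ℚ-ring
    d≡ : d ≡ A * A + A * C + C * C + - b
    d≡ = trans (isolate-d A b C d) (trans
      (cong (_+ (A * A + A * C + C * C + - b)) (trans (cong (λ R → b + d + A * C + R * (A + C)) (sym R≡-q)) e₃))
      (+-identityˡ _))
    e₁′ : let d = A * A + A * C + C * C + - b in b * d + - ((A + C) * (A * d + C * b)) ≡ 0ℚ
    e₁′ = subst (λ d → b * d + - ((A + C) * (A * d + C * b)) ≡ 0ℚ) d≡ (begin
      b * d + - ((A + C) * (A * d + C * b))   ≡⟨ cong (λ x → b * d + x) (neg-distribˡ-* (A + C) (A * d + C * b)) ⟩
      b * d + - (A + C) * (A * d + C * b)     ≡⟨ cong (λ R → b * d + R * (A * d + C * b)) R≡-q ⟨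
      b * d + R * (A * d + C * b)             ≡⟨ e₁ ⟩
      0ℚ                                      ∎)

  general-factors : ∀ l₀ l₁ a₀ a₁ a₂ b₀ b₁ b₂ →
    l₁ * (a₂ * b₂) ≡ 1ℚ →
    l₀ * (a₂ * b₂) + l₁ * (a₁ * b₂ + a₂ * b₁) ≡ 0ℚ →
    l₀ * (a₁ * b₂ + a₂ * b₁) + l₁ * (a₀ * b₂ + (a₁ * b₁ + a₂ * b₀)) ≡ 0ℚ →
    l₀ * (a₀ * b₁ + a₁ * b₀) + l₁ * (a₀ * b₀) ≡ 0ℚ →
    l₀ * (a₀ * b₀) ≡ 0ℚ
  -- Since l₁ a₂ b₂ = 1, a factor is made monic by multiplying it by the product
  -- of the other two leading coefficients.
  general-factors l₀ l₁ a₀ a₁ a₂ b₀ b₁ b₂ e₅ e₄ e₃ e₁ =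
    trans (sym (normalise (λ k → l₀ * (a₀ * b₀) * (k * k)) (monic₀ l₀ l₁ a₀ a₂ b₀ b₂) (*-identityʳ _)))
    (monic-factors R A b C d (trans (monic₄ l₀ l₁ a₁ a₂ b₁ b₂) e₄)
      (trans (normalise
        (λ k → l₀ * (a₁ * b₂ + a₂ * b₁) * k + l₁ * (a₀ * b₂ + (a₁ * b₁ * k + a₂ * b₀)))
        (monic₃ l₀ l₁ a₀ a₁ a₂ b₀ b₁ b₂) (unscale₃ l₀ l₁ a₀ a₁ a₂ b₀ b₁ b₂)) e₃)
      (trans (normalise
        (λ k → l₀ * (a₀ * b₁ + a₁ * b₀) * (k * k) + l₁ * (a₀ * b₀) * k)
        (monic₁ l₀ l₁ a₀ a₁ a₂ b₀ b₁ b₂) (unscale₁ (l₀ * (a₀ * b₁ + a₁ * b₀)) (l₁ * (a₀ * b₀)))) e₁))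
    where
    R A b C d : ℚ
    R = l₀ * (a₂ * b₂)
    A = l₁ * b₂ * a₁
    b = l₁ * b₂ * a₀
    C = l₁ * a₂ * b₁
    d = l₁ * a₂ * b₀
    normalise : ∀ {x z} (f : ℚ → ℚ) → x ≡ f (l₁ * (a₂ * b₂)) → f 1ℚ ≡ z → x ≡ z
    normalise f x≡ ≡z = trans x≡ (trans (cong f e₅) ≡z)
    monic₀ : ∀ l₀ l₁ a₀ a₂ b₀ b₂ → l₀ * (a₂ * b₂) * (l₁ * b₂ * a₀ * (l₁ * a₂ * b₀)) ≡
      l₀ * (a₀ * b₀) * (l₁ * (a₂ * b₂) * (l₁ * (a₂ * b₂)))
    monic₀ = RingSolver.solve-∀ ℚ-ring
    monic₁ : ∀ l₀ l₁ a₀ a₁ a₂ b₀ b₁ b₂ →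
      l₁ * b₂ * a₀ * (l₁ * a₂ * b₀) +
        l₀ * (a₂ * b₂) * (l₁ * b₂ * a₁ * (l₁ * a₂ * b₀) + l₁ * a₂ * b₁ * (l₁ * b₂ * a₀)) ≡
      l₀ * (a₀ * b₁ + a₁ * b₀) * (l₁ * (a₂ * b₂) * (l₁ * (a₂ * b₂))) + l₁ * (a₀ * b₀) * (l₁ * (a₂ * b₂))
    monic₁ = RingSolver.solve-∀ ℚ-ring
    monic₃ : ∀ l₀ l₁ a₀ a₁ a₂ b₀ b₁ b₂ →
      l₁ * b₂ * a₀ + l₁ * a₂ * b₀ + l₁ * b₂ * a₁ * (l₁ * a₂ * b₁) + l₀ * (a₂ * b₂) * (l₁ * b₂ * a₁ + l₁ * a₂ * b₁) ≡
      l₀ * (a₁ * b₂ + a₂ * b₁) * (l₁ * (a₂ * b₂)) + l₁ * (a₀ * b₂ + (a₁ * b₁ * (l₁ * (a₂ * b₂)) + a₂ * b₀))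
    monic₃ = RingSolver.solve-∀ ℚ-ring
    monic₄ : ∀ l₀ l₁ a₁ a₂ b₁ b₂ →
      l₀ * (a₂ * b₂) + (l₁ * b₂ * a₁ + l₁ * a₂ * b₁) ≡ l₀ * (a₂ * b₂) + l₁ * (a₁ * b₂ + a₂ * b₁)
    monic₄ = RingSolver.solve-∀ ℚ-ring
    unscale₁ : ∀ x y → x * 1ℚ + y * 1ℚ ≡ x + y
    unscale₁ = RingSolver.solve-∀ ℚ-ring
    unscale₃ : ∀ l₀ l₁ a₀ a₁ a₂ b₀ b₁ b₂ →
      l₀ * (a₁ * b₂ + a₂ * b₁) * 1ℚ + l₁ * (a₀ * b₂ + (a₁ * b₁ * 1ℚ + a₂ * b₀)) ≡
      l₀ * (a₁ * b₂ + a₂ * b₁) + l₁ * (a₀ * b₂ + (a₁ * b₁ + a₂ * b₀))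
    unscale₃ = RingSolver.solve-∀ ℚ-ring

-- Coefficients of products of polynomials

open Factorisation using (ℚ-ring; general-factors)
open import Data.List.Relation.Binary.Pointwise using (_∷_; [])
open import Defs

coeff-+ : ∀ p q n → coeff (p + q) n ≡ coeff p n ℚ.+ coeff q n
coeff-+ []      q       n       = sym (ℚ.+-identityˡ _)
coeff-+ (a ∷ p) []      n       = sym (ℚ.+-identityʳ _)
coeff-+ (a ∷ p) (b ∷ q) zero    = refl
coeff-+ (a ∷ p) (b ∷ q) (suc n) = coeff-+ p q n

coeff-map : ∀ a q n → coeff (map (a ℚ.*_) q) n ≡ a ℚ.* coeff q n
coeff-map a []      n       = sym (ℚ.*-zeroʳ a)
coeff-map a (b ∷ q) zero    = refl
coeff-map a (b ∷ q) (suc n) = coeff-map a q n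

tail : ℚ[x] → ℚ[x]
tail = drop 1

coeff-tail : ∀ p n → coeff (tail p) n ≡ coeff p (suc n)
coeff-tail []      n = refl
coeff-tail (a ∷ p) n = refl

coeff-*-zero : ∀ p q → coeff (p * q) 0 ≡ coeff p 0 ℚ.* coeff q 0
coeff-*-zero []      q = sym (ℚ.*-zeroˡ (coeff q 0))
coeff-*-zero (a ∷ p) q = trans (coeff-+ (map (a ℚ.*_) q) (0ℚ ∷ p * q) 0)
  (trans (ℚ.+-identityʳ _) (coeff-map a q 0))

-- Valid for `[]` too, by the default 0 of `coeff`; degree bounds can therefore be peeled off
-- without inspecting the list.
coeff-*-suc : ∀ p q n → coeff (p * q) (suc n) ≡ coeff p 0 ℚ.* coeff q (suc n) ℚ.+ coeff (tail p * q) n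
coeff-*-suc []      q n = sym (trans (ℚ.+-identityʳ _) (ℚ.*-zeroˡ (coeff q (suc n))))
coeff-*-suc (a ∷ p) q n = trans (coeff-+ (map (a ℚ.*_) q) (0ℚ ∷ p * q) (suc n))
  (cong (ℚ._+ coeff (p * q) n) (coeff-map a q (suc n)))

coeff-*-one : ∀ p n → coeff (p * (1ℚ ∷ [])) n ≡ coeff p n
coeff-*-one p zero    = trans (coeff-*-zero p (1ℚ ∷ [])) (ℚ.*-identityʳ _)
coeff-*-one p (suc n) = trans (coeff-*-suc p (1ℚ ∷ []) n) (trans
  (cong₂ ℚ._+_ (ℚ.*-zeroʳ (coeff p 0)) (trans (coeff-*-one (tail p) n) (coeff-tail p n)))
  (ℚ.+-identityˡ _))

Degree≤ : ℕ → ℚ[x] → Set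
Degree≤ d p = ∀ m → d ℕ.< m → coeff p m ≡ 0ℚ

tail-degree : ∀ {d} p → Degree≤ (suc d) p → Degree≤ d (tail p)
tail-degree p p≤ m d<m = trans (coeff-tail p m) (p≤ (suc m) (s≤s d<m))

zero-* : ∀ p q → (∀ m → coeff p m ≡ 0ℚ) → ∀ n → coeff (p * q) n ≡ 0ℚ
zero-* p q p≡0 zero    = trans (coeff-*-zero p q) (trans (cong (ℚ._* coeff q 0) (p≡0 0)) (ℚ.*-zeroˡ (coeff q 0)))
zero-* p q p≡0 (suc n) = trans (coeff-*-suc p q n) (cong₂ ℚ._+_
  (trans (cong (ℚ._* coeff q (suc n)) (p≡0 0)) (ℚ.*-zeroˡ (coeff q (suc n))))
  (zero-* (tail p) q (λ m → trans (coeff-tail p m) (p≡0 (suc m))) n))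

constant-* : ∀ p q → Degree≤ 0 p → ∀ n → coeff (p * q) n ≡ coeff p 0 ℚ.* coeff q n
constant-* p q p≤ zero    = coeff-*-zero p q
constant-* p q p≤ (suc n) = trans (coeff-*-suc p q n) (trans
  (cong (coeff p 0 ℚ.* coeff q (suc n) ℚ.+_)
    (zero-* (tail p) q (λ m → trans (coeff-tail p m) (p≤ (suc m) (s≤s z≤n))) n))
  (ℚ.+-identityʳ _))

linear-* : ∀ p q → Degree≤ 1 p → ∀ n →
  coeff (p * q) (suc n) ≡ coeff p 0 ℚ.* coeff q (suc n) ℚ.+ coeff p 1 ℚ.* coeff q n
linear-* p q p≤ n = trans (coeff-*-suc p q n) (cong (coeff p 0 ℚ.* coeff q (suc n) ℚ.+_)
  (trans (constant-* (tail p) q (tail-degree p p≤) n) (cong (ℚ._* coeff q n) (coeff-tail p 0))))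

-- The coefficients of r are those of (a₀ + a₁ x + a₂ x²) q.
record QuadraticMultiple (r q : ℚ[x]) : Set where
  field
    a₀ a₁ a₂ : ℚ
    coeff-0  : coeff r 0 ≡ a₀ ℚ.* coeff q 0
    coeff-1  : coeff r 1 ≡ a₀ ℚ.* coeff q 1 ℚ.+ a₁ ℚ.* coeff q 0
    coeff-2+ : ∀ n → coeff r (2 ℕ.+ n) ≡
      a₀ ℚ.* coeff q (2 ℕ.+ n) ℚ.+ (a₁ ℚ.* coeff q (1 ℕ.+ n) ℚ.+ a₂ ℚ.* coeff q n)

quadratic-* : ∀ p q → Degree≤ 2 p → QuadraticMultiple (p * q) q
quadratic-* p q p≤ = record
  { a₀       = coeff p 0
  ; a₁       = coeff p 1
  ; a₂       = coeff p 2
  ; coeff-0  = coeff-*-zero p q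
  ; coeff-1  = trans (coeff-*-suc p q 0) (cong (λ x → coeff p 0 ℚ.* coeff q 1 ℚ.+ x)
      (trans (coeff-*-zero (tail p) q) (cong (ℚ._* coeff q 0) (coeff-tail p 0))))
  ; coeff-2+ = λ n → trans (coeff-*-suc p q (suc n)) (cong (λ x → coeff p 0 ℚ.* coeff q (2 ℕ.+ n) ℚ.+ x)
      (trans (linear-* (tail p) q (tail-degree p p≤) n)
        (cong₂ (λ x y → x ℚ.* coeff q (suc n) ℚ.+ y ℚ.* coeff q n) (coeff-tail p 0) (coeff-tail p 1))))
  }

-- Brings type (1,1,1,2) to the shape of (1,2,2): two linear factors act as one quadratic factor,
-- which may be reducible.
linear-*-linear-* : ∀ f g q → Degree≤ 1 f → Degree≤ 1 g → QuadraticMultiple (f * (g * q)) q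
linear-*-linear-* f g q f≤ g≤ = record
  { a₀       = f₀ ℚ.* g₀
  ; a₁       = f₀ ℚ.* g₁ ℚ.+ f₁ ℚ.* g₀
  ; a₂       = f₁ ℚ.* g₁
  ; coeff-0  = trans (coeff-*-zero f (g * q)) (trans (cong (f₀ ℚ.*_) (coeff-*-zero g q)) (expand₀ f₀ g₀ (coeff q 0)))
  ; coeff-1  = trans (linear-* f (g * q) f≤ 0) (trans
      (cong₂ (λ x y → f₀ ℚ.* x ℚ.+ f₁ ℚ.* y) (linear-* g q g≤ 0) (coeff-*-zero g q))
      (expand₁ f₀ f₁ g₀ g₁ (coeff q 0) (coeff q 1)))
  ; coeff-2+ = λ n → trans (linear-* f (g * q) f≤ (suc n)) (trans
      (cong₂ (λ x y → f₀ ℚ.* x ℚ.+ f₁ ℚ.* y) (linear-* g q g≤ (suc n)) (linear-* g q g≤ n))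
      (expand₂ f₀ f₁ g₀ g₁ (coeff q n) (coeff q (1 ℕ.+ n)) (coeff q (2 ℕ.+ n))))
  }
  where
  f₀ f₁ g₀ g₁ : ℚ
  f₀ = coeff f 0
  f₁ = coeff f 1
  g₀ = coeff g 0
  g₁ = coeff g 1
  expand₀ : ∀ f₀ g₀ x → f₀ ℚ.* (g₀ ℚ.* x) ≡ f₀ ℚ.* g₀ ℚ.* x
  expand₀ = RingSolver.solve-∀ ℚ-ring
  expand₁ : ∀ f₀ f₁ g₀ g₁ x y → f₀ ℚ.* (g₀ ℚ.* y ℚ.+ g₁ ℚ.* x) ℚ.+ f₁ ℚ.* (g₀ ℚ.* x) ≡
    f₀ ℚ.* g₀ ℚ.* y ℚ.+ (f₀ ℚ.* g₁ ℚ.+ f₁ ℚ.* g₀) ℚ.* x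
  expand₁ = RingSolver.solve-∀ ℚ-ring
  expand₂ : ∀ f₀ f₁ g₀ g₁ x y z → f₀ ℚ.* (g₀ ℚ.* z ℚ.+ g₁ ℚ.* y) ℚ.+ f₁ ℚ.* (g₀ ℚ.* y ℚ.+ g₁ ℚ.* x) ≡
    f₀ ℚ.* g₀ ℚ.* z ℚ.+ ((f₀ ℚ.* g₁ ℚ.+ f₁ ℚ.* g₀) ℚ.* y ℚ.+ f₁ ℚ.* g₁ ℚ.* x)
  expand₂ = RingSolver.solve-∀ ℚ-ring

-- The trinomial has coefficients 1, 0, 0, 0 at x⁵, x⁴, x³, x; compared with those of `l * r` they
-- are the four equations of `general-factors`.
constant-term≡0 : ∀ {A B l r q} → Degree≤ 1 l → Degree≤ 2 q → QuadraticMultiple r q →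
  trinomial A B ≈ l * r → B ≡ 0ℚ
constant-term≡0 {A} {B} {l} {r} {q} l≤ q≤ r-multiple eq = trans (trans (eq 0) (coeff-*-zero l r))
  (trans (cong (l₀ ℚ.*_) coeff-0) (general-factors l₀ l₁ a₀ a₁ a₂ b₀ b₁ b₂ e₅ e₄ e₃ e₁))
  where
  open QuadraticMultiple r-multiple
  l₀ l₁ b₀ b₁ b₂ : ℚ
  l₀ = coeff l 0
  l₁ = coeff l 1
  b₀ = coeff q 0
  b₁ = coeff q 1
  b₂ = coeff q 2
  drop₁ : ∀ a x → a ℚ.* 0ℚ ℚ.+ x ≡ x
  drop₁ = RingSolver.solve-∀ ℚ-ring
  r₃ : coeff r 3 ≡ a₁ ℚ.* b₂ ℚ.+ a₂ ℚ.* b₁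
  r₃ = trans (coeff-2+ 1) (trans
    (cong (λ x → a₀ ℚ.* x ℚ.+ (a₁ ℚ.* b₂ ℚ.+ a₂ ℚ.* b₁)) (q≤ 3 (s≤s (s≤s (s≤s z≤n)))))
    (drop₁ a₀ _))
  r₄ : coeff r 4 ≡ a₂ ℚ.* b₂
  r₄ = trans (coeff-2+ 2) (trans
    (cong₂ (λ x y → a₀ ℚ.* x ℚ.+ (a₁ ℚ.* y ℚ.+ a₂ ℚ.* b₂))
      (q≤ 4 (s≤s (s≤s (s≤s z≤n)))) (q≤ 3 (s≤s (s≤s (s≤s z≤n)))))
    (trans (drop₁ a₀ _) (drop₁ a₁ _)))
  r₅ : coeff r 5 ≡ 0ℚ
  r₅ = trans (coeff-2+ 3) (trans
    (cong₂ (λ x y → a₀ ℚ.* x ℚ.+ (a₁ ℚ.* y ℚ.+ a₂ ℚ.* coeff q 3))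
      (q≤ 5 (s≤s (s≤s (s≤s z≤n)))) (q≤ 4 (s≤s (s≤s (s≤s z≤n)))))
    (trans (drop₁ a₀ _) (trans (drop₁ a₁ _)
      (trans (cong (a₂ ℚ.*_) (q≤ 3 (s≤s (s≤s (s≤s z≤n))))) (ℚ.*-zeroʳ a₂)))))
  coefficient : ∀ n {x y} → coeff r (suc n) ≡ x → coeff r n ≡ y →
    l₀ ℚ.* x ℚ.+ l₁ ℚ.* y ≡ coeff (trinomial A B) (suc n)
  coefficient n refl refl = sym (trans (eq (suc n)) (linear-* l r l≤ n))
  e₅ : l₁ ℚ.* (a₂ ℚ.* b₂) ≡ 1ℚ
  e₅ = trans (sym (drop₁ l₀ _)) (coefficient 4 r₅ r₄)
  e₄ : l₀ ℚ.* (a₂ ℚ.* b₂) ℚ.+ l₁ ℚ.* (a₁ ℚ.* b₂ ℚ.+ a₂ ℚ.* b₁) ≡ 0ℚ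
  e₄ = coefficient 3 r₄ r₃
  e₃ : l₀ ℚ.* (a₁ ℚ.* b₂ ℚ.+ a₂ ℚ.* b₁) ℚ.+ l₁ ℚ.* (a₀ ℚ.* b₂ ℚ.+ (a₁ ℚ.* b₁ ℚ.+ a₂ ℚ.* b₀)) ≡ 0ℚ
  e₃ = coefficient 2 r₃ (coeff-2+ 0)
  e₁ : l₀ ℚ.* (a₀ ℚ.* b₁ ℚ.+ a₁ ℚ.* b₀) ℚ.+ l₁ ℚ.* (a₀ ℚ.* b₀) ≡ 0ℚ
  e₁ = coefficient 0 coeff-1 coeff-0

-- `product` ends in the constant 1, so the last factor occurs multiplied by it.
*-one-degree : ∀ {d} p → Degree≤ d p → Degree≤ d (p * (1ℚ ∷ []))
*-one-degree p p≤ m d<m = trans (coeff-*-one p m) (p≤ m d<m)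

theorem3p2 : (A B : ℚ) → A ℚ.* B ≢ 0ℚ →
    ¬ (HasReducibilityType (trinomial A B) (1 ∷ 2 ∷ 2 ∷ [])
    ⊎ HasReducibilityType (trinomial A B) (1 ∷ 1 ∷ 1 ∷ 2 ∷ []))
theorem3p2 A B AB≢0 types = AB≢0 (trans (cong (A ℚ.*_) (B≡0 types)) (ℚ.*-zeroʳ A))
  where
  B≡0 : HasReducibilityType (trinomial A B) (1 ∷ 2 ∷ 2 ∷ [])
    ⊎ HasReducibilityType (trinomial A B) (1 ∷ 1 ∷ 1 ∷ 2 ∷ []) → B ≡ 0ℚ
  B≡0 (inj₁ record { factors = l ∷ f ∷ g ∷ [] ; factorisation = eq
                   ; factors-irreducible = (_ , _ , l≤) ∷ (_ , _ , f≤) ∷ (_ , _ , g≤) ∷ [] }) =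
    constant-term≡0 {A} {l = l} l≤ (*-one-degree g g≤) (quadratic-* f _ f≤) eq
  B≡0 (inj₂ record { factors = l ∷ f ∷ g ∷ h ∷ [] ; factorisation = eq
                   ; factors-irreducible = (_ , _ , l≤) ∷ (_ , _ , f≤) ∷ (_ , _ , g≤) ∷ (_ , _ , h≤) ∷ [] }) =
    constant-term≡0 {A} {l = l} l≤ (*-one-degree h h≤) (linear-*-linear-* f g _ f≤ g≤) eq
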